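{- A monotonicity constraint system (MCS) $\mathcal A$ is terminating if and only if it is size-change terminating.
   Context: Fix a number $n$ of variables. A monotonicity constraint (MC) is a finite conjunction of constraints $u\rhd v$ with $\rhd\in\{>,\ge\}$ and $u,v\in\{x_1,\dots,x_n,x_1',\dots,x_n'\}$ (unprimed: source state; primed: target state; $u=v$ abbreviates $u\ge v\wedge v\ge u$). It is identified with the labeled digraph on these $2n$ nodes having an arc $u\to v$ labeled $\rhd$ for each constraint $u\rhd v$; arcs labeled $>$ are called strict, arcs labeled $\ge$ non-strict. An MCS $\mathcal A$ consists of a finite set $F$ of flow-points; a finite directed graph (control-flow graph, CFG; loops and parallel arcs allowed) on $F$; for every CFG arc $f\to g$ an MC $G$ labeling it (written $G:f\to g$); and for every flow-point $f$ an invariant $I_f$, a conjunction of constraints $u\rhd v$ with $u,v\in\{x_1,\dots,x_n\}$ (also viewed as labeled arcs). Semantics: let $\mathit{Val}$ be a well-ordered set. A state is a pair $(f,\sigma)$ with $f\in F$, $\sigma:\{1,\dots,n\}\to\mathit{Val}$. For $G:f\to g$ in $\mathcal A$, there is a transition $(f,\sigma)\mapsto(g,\sigma')$ if $\sigma\models I_f$, $\sigma'\models I_g$ and $\sigma,\sigma'\models G$ (unprimed variables valued by $\sigma$, primed by $\sigma'$). $\mathcal A$ is terminating if, for every choice of well-ordered set $\mathit{Val}$, there is no infinite sequence of states in which each consecutive pair is a transition described by some MC of $\mathcal A$. Multipaths: for a (finite or infinite) labeled CFG path $f_0\xrightarrow{G_1}f_1\xrightarrow{G_2}f_2\cdots$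 (repetitions allowed), the corresponding $\mathcal A$-multipath is the labeled digraph with nodes $x[t,i]$ ($t$ from $0$ up to the length of the path, $1\le i\le n$), whose arcs are: for each $t\ge1$, the arcs of $G_t$ with $x_i$ renamed to $x[t-1,i]$ and $x_j'$ renamed to $x[t,j]$; and for each $t\ge0$, the arcs of $I_{f_t}$ with $x_i$ renamed to $x[t,i]$. A walk (nodes and arcs may repeat; arcs may go forward, backward or stay at the same $t$) is infinitely descending if it contains infinitely many occurrences of strict arcs (in particular, going forever around a cycle containing a strict arc counts). $\mathcal A$ is size-change terminating if every infinite $\mathcal A$-multipath has an infinitely descending walk. -}

module Defs where

open import Level using (Level; suc; _⊔_)
open import Data.Nat.Base as ℕ using (ℕ)
open import Data.Fin.Base using (Fin)
open import Data.List.Base using (List)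
open import Data.List.Membership.Propositional using (_∈_)
open import Data.List.Relation.Unary.All using (All)
open import Data.Product.Base using (Σ-syntax; ∃-syntax; _×_; _,_)
open import Induction.WellFounded using (WellFounded)
open import Relation.Binary.Bundles using (StrictTotalOrder)
import Relation.Binary.Construct.StrictToNonStrict as StrictToNonStrict
open import Relation.Binary.PropositionalEquality.Core using (_≡_)
open import Relation.Nullary.Negation.Core using (¬_)

data Label : Set where
  strict nonstrict : Label

infix 5 _▷[_]_

-- u ▷[ strict ] v is the constraint u > v, u ▷[ nonstrict ] v is u ≥ v.
-- An equality u = v is given by two nonstrict constraints.
data Constraint (V : Set) : Set where
  _▷[_]_ : (u : V) (r : Label) (v : V) → Constraint V

data Var (n : ℕ) : Set where
  unprimed primed : Fin n → Var n

-- Lists are read as conjunctions, and also as the arc sets of digraphs.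
MC : ℕ → Set
MC n = List (Constraint (Var n))

Invariant : ℕ → Set
Invariant n = List (Constraint (Fin n))

-- CFG arcs are identified by an index, so loops and parallel arcs are allowed.
record MCS (n : ℕ) : Set where
  field
    #flowPoints #arcs : ℕ

  FlowPoint : Set
  FlowPoint = Fin #flowPoints

  CFGArc : Set
  CFGArc = Fin #arcs

  field
    source target : CFGArc → FlowPoint
    mc            : CFGArc → MC n
    invariant     : FlowPoint → Invariant n

------------------------------------------------------------------------
-- Semantics

-- The equality of the order is an arbitrary equivalence _≈_ on the carrier,
-- since quotient sets are not available as types.
record WellOrderedSet (c ℓ₁ ℓ₂ : Level) : Set (suc (c ⊔ ℓ₁ ⊔ ℓ₂)) where
  field
    strictTotalOrder : StrictTotalOrder c ℓ₁ ℓ₂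

  open StrictTotalOrder strictTotalOrder public
    using (Carrier; _≈_; _<_)

  field
    <-wellFounded : WellFounded _<_

  open StrictToNonStrict _≈_ _<_ public using (_≤_)

module Semantics {c ℓ₁ ℓ₂ : Level} (Val : WellOrderedSet c ℓ₁ ℓ₂) where
  open WellOrderedSet Val

  data Holds {V : Set} (ρ : V → Carrier) : Constraint V → Set (c ⊔ ℓ₁ ⊔ ℓ₂) where
    holds-strict    : ∀ {u v} → ρ v < ρ u → Holds ρ (u ▷[ strict ] v)
    holds-nonstrict : ∀ {u v} → ρ v ≤ ρ u → Holds ρ (u ▷[ nonstrict ] v)

  _⊨_ : {V : Set} → (V → Carrier) → List (Constraint V) → Set (c ⊔ ℓ₁ ⊔ ℓ₂)
  ρ ⊨ C = All (Holds ρ) C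

  joint : ∀ {n} → (σ σ′ : Fin n → Carrier) → Var n → Carrier
  joint σ σ′ (unprimed i) = σ i
  joint σ σ′ (primed i)   = σ′ i

  module _ {n : ℕ} (A : MCS n) where
    open MCS A

    State : Set c
    State = FlowPoint × (Fin n → Carrier)

    Transition : State → State → Set (c ⊔ ℓ₁ ⊔ ℓ₂)
    Transition (f , σ) (g , σ′) =
      Σ[ a ∈ CFGArc ]
        source a ≡ f × target a ≡ g ×
        (σ ⊨ invariant f) × (σ′ ⊨ invariant g) × (joint σ σ′ ⊨ mc a)

    InfiniteRun : Set (c ⊔ ℓ₁ ⊔ ℓ₂)
    InfiniteRun =
      Σ[ s ∈ (ℕ → State) ] (∀ t → Transition (s t) (s (ℕ.suc t)))

-- "Every well-ordered set" is every one in the given universes.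
Terminating : ∀ (c ℓ₁ ℓ₂ : Level) {n} → MCS n → Set (suc (c ⊔ ℓ₁ ⊔ ℓ₂))
Terminating c ℓ₁ ℓ₂ A =
  (Val : WellOrderedSet c ℓ₁ ℓ₂) → ¬ Semantics.InfiniteRun Val A

------------------------------------------------------------------------
-- Multipaths

module _ {n : ℕ} (A : MCS n) where
  open MCS A

  -- The CFG arc leading from flowPoint t to flowPoint (t + 1) is arc t; its
  -- MC is the one usually written G with subscript t + 1.
  record InfinitePath : Set where
    field
      flowPoint  : ℕ → FlowPoint
      arc        : ℕ → CFGArc
      source-arc : ∀ t → source (arc t) ≡ flowPoint t
      target-arc : ∀ t → target (arc t) ≡ flowPoint (ℕ.suc t)

-- (t , i) stands for x[t,i].
Node : ℕ → Set
Node n = ℕ × Fin n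

place : ∀ {n} → ℕ → Var n → Node n
place t (unprimed i) = t , i
place t (primed i)   = ℕ.suc t , i

data MultipathArc {n : ℕ} {A : MCS n} (π : InfinitePath A) :
                  Node n → Label → Node n → Set where
  mc-arc  : ∀ t {u r v} →
            (u ▷[ r ] v) ∈ MCS.mc A (InfinitePath.arc π t) →
            MultipathArc π (place t u) r (place t v)
  inv-arc : ∀ t {i r j} →
            (i ▷[ r ] j) ∈ MCS.invariant A (InfinitePath.flowPoint π t) →
            MultipathArc π (t , i) r (t , j)

record InfiniteWalk {n : ℕ} {A : MCS n} (π : InfinitePath A) : Set where
  field
    node  : ℕ → Node n
    label : ℕ → Label
    step  : ∀ k → MultipathArc π (node k) (label k) (node (ℕ.suc k))

InfinitelyDescending : ∀ {n} {A : MCS n} {π : InfinitePath A} →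
                       InfiniteWalk π → Set
InfinitelyDescending w = ∀ k → ∃[ l ] (k ℕ.≤ l × InfiniteWalk.label w l ≡ strict)

SizeChangeTerminating : ∀ {n} → MCS n → Set
SizeChangeTerminating A =
  (π : InfinitePath A) → Σ[ w ∈ InfiniteWalk π ] InfinitelyDescending w

{-# OPTIONS --safe #-}

-- A run assigns values to the nodes of its multipath so that every walk is
-- weakly decreasing, and strictly so at strict arcs; hence an infinitely
-- descending walk contradicts well-foundedness.  Conversely, in a multipath
-- without such a walk, "v is reached from u by a walk ending with a strict arc"
-- is a well-founded relation on the nodes.  Comparing nodes by their ordinal
-- rank in it makes the set of nodes itself a well-ordered set (two nodes of
-- the same rank being equal), in which each node can serve as its own value.
module Submission where

open import Defs
open import Level using (Level; 0ℓ; Lift; lift; lower)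
open import Axiom.ExcludedMiddle using (ExcludedMiddle)
open import Data.Empty using (⊥)
import Data.List.Relation.Unary.All as All
open import Data.Nat.Base as ℕ using (ℕ; zero)
open import Data.Nat.Properties using (≤-refl; ≤⇒≤′; <⇒≤)
open import Data.Product.Base using (Σ; Σ-syntax; ∃-syntax; _×_; _,_; proj₁; proj₂; swap)
open import Data.Sum.Base using (_⊎_; inj₁; inj₂)
open import Function.Base using (_∘_)
open import Function.Bundles using (_⇔_; mk⇔)
open import Induction.WellFounded using (WellFounded; Acc; acc)
open import Relation.Binary.Bundles using (StrictTotalOrder)
open import Relation.Binary.Core using (Rel)
open import Relation.Binary.Structures using (IsEquivalence)
open import Relation.Binary.Definitions using (Transitive; Reflexive; Trichotomous; tri<; tri≈; tri>)
import Relation.Binary.Construct.StrictToNonStrict as StrictToNonStrict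
open import Relation.Binary.PropositionalEquality.Core using (_≡_; refl; sym; cong; subst₂)
open import Relation.Nullary.Decidable.Core using (yes; no; decidable-stable)
open import Relation.Nullary.Negation.Core using (¬_; contradiction)

-- Comparison of elements by ordinal rank

module Rank {A : Set} {_<_ : Rel A 0ℓ}
            (<-trans : Transitive _<_) (<-wf : WellFounded _<_) where

  infix 4 _≼_ _≺_ _≃_

  -- This is rank x ≤ rank y, where the rank of an element is the least ordinal above the ranks of
  -- everything below it. The simulation form expresses this without ordinals.
  data _≼_ (x y : A) : Set where
    below : (∀ {x′} → x′ < x → ∃[ y′ ] (y′ < y × x′ ≼ y′)) → x ≼ y

  _≺_ : Rel A 0ℓ
  x ≺ y = ∃[ y′ ] (y′ < y × x ≼ y′)

  _≃_ : Rel A 0ℓ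
  x ≃ y = x ≼ y × y ≼ x

  ≼-refl : Reflexive _≼_
  ≼-refl {x} = go (<-wf x)
    where
    go : ∀ {x} → Acc _<_ x → x ≼ x
    go (acc rs) = below λ x′<x → _ , x′<x , go (rs x′<x)

  ≼-trans : Transitive _≼_
  ≼-trans (below f) (below g) = below λ x′<x →
    let y′ , y′<y , x′≼y′ = f x′<x
        z′ , z′<z , y′≼z′ = g y′<y
    in z′ , z′<z , ≼-trans x′≼y′ y′≼z′

  <⇒≺ : ∀ {x y} → x < y → x ≺ y
  <⇒≺ x<y = _ , x<y , ≼-refl

  -- What matches `x′` lies below `y′`, hence below `y` by transitivity of `_<_`.
  ≺⇒≼ : ∀ {x y} → x ≺ y → x ≼ y
  ≺⇒≼ (y′ , y′<y , below f) = below λ x′<x →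
    let y″ , y″<y′ , x′≼y″ = f x′<x
    in y″ , <-trans y″<y′ y′<y , x′≼y″

  ≺-≼-trans : ∀ {x y z} → x ≺ y → y ≼ z → x ≺ z
  ≺-≼-trans (y′ , y′<y , x≼y′) (below g) =
    let z′ , z′<z , y′≼z′ = g y′<y in z′ , z′<z , ≼-trans x≼y′ y′≼z′

  ≼-≺-trans : ∀ {x y z} → x ≼ y → y ≺ z → x ≺ z
  ≼-≺-trans x≼y (z′ , z′<z , y≼z′) = z′ , z′<z , ≼-trans x≼y y≼z′

  -- Induction on an upper bound `y` of `x`: each `z ≺ x` is bounded by some `y′ < y`, so
  -- accessibility of `y` passes to `x`.
  ≺-wellFounded : WellFounded _≺_
  ≺-wellFounded x = go (<-wf x) ≼-refl
    where
    go : ∀ {x y} → Acc _<_ y → x ≼ y → Acc _≺_ x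
    go (acc rs) x≼y = acc λ z≺x →
      let y′ , y′<y , z≼y′ = ≺-≼-trans z≺x x≼y in go (rs y′<y) z≼y′

  ≺-irrefl : ∀ {x} → ¬ (x ≺ x)
  ≺-irrefl {x} = go (≺-wellFounded x)
    where
    go : ∀ {x} → Acc _≺_ x → ¬ (x ≺ x)
    go (acc rs) x≺x = go (rs x≺x) x≺x

  ≺⇒⋡ : ∀ {x y} → x ≺ y → ¬ (y ≼ x)
  ≺⇒⋡ x≺y y≼x = ≺-irrefl (≺-≼-trans x≺y y≼x)

  module _ (em : ExcludedMiddle 0ℓ) where

    ≼-or-≻ : ∀ x y → x ≼ y ⊎ y ≺ x
    ≼-or-≻ x = go (<-wf x)
      where
      go : ∀ {x} → Acc _<_ x → ∀ y → x ≼ y ⊎ y ≺ x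
      go {x} (acc rs) y with em {Σ[ x′ ∈ A ] (x′ < x × ¬ (x′ ≺ y))}
      ... | no none = inj₁ (below λ x′<x →
              decidable-stable em λ x′⊀y → none (_ , x′<x , x′⊀y))
      -- Here `y ≼ x′`: for `y′ < y`, having `x′ ≼ y′` would give `x′ ≺ y`, so the induction
      -- hypothesis at `x′` leaves only `y′ ≺ x′`.
      ... | yes (x′ , x′<x , x′⊀y) = inj₂ (x′ , x′<x , below y′≺x′)
        where
        y′≺x′ : ∀ {y′} → y′ < y → y′ ≺ x′
        y′≺x′ {y′} y′<y with go (rs x′<x) y′
        ... | inj₁ x′≼y′ = contradiction (y′ , y′<y , x′≼y′) x′⊀y
        ... | inj₂ y′≺x′ = y′≺x′

    ≺-compare : Trichotomous _≃_ _≺_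
    ≺-compare x y with ≼-or-≻ x y | ≼-or-≻ y x
    ... | inj₁ x≼y | inj₁ y≼x =
            tri≈ (λ x≺y → ≺⇒⋡ x≺y y≼x) (x≼y , y≼x) (λ y≺x → ≺⇒⋡ y≺x x≼y)
    ... | inj₁ x≼y | inj₂ x≺y =
            tri< x≺y (≺⇒⋡ x≺y ∘ proj₂) (λ y≺x → ≺⇒⋡ y≺x x≼y)
    ... | inj₂ y≺x | _        =
            tri> (λ x≺y → ≺⇒⋡ x≺y (≺⇒≼ y≺x)) (≺⇒⋡ y≺x ∘ proj₁) y≺x

    -- The lifts bring the order to whatever levels `Terminating` prescribes.
    wellOrderedSet : ∀ c ℓ₁ ℓ₂ → WellOrderedSet c ℓ₁ ℓ₂
    wellOrderedSet c ℓ₁ ℓ₂ = record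
      { strictTotalOrder = record
        { Carrier = Lift c A
        ; _≈_ = λ x y → Lift ℓ₁ (lower x ≃ lower y)
        ; _<_ = λ x y → Lift ℓ₂ (lower x ≺ lower y)
        ; isStrictTotalOrder = record
          { isStrictPartialOrder = record
            { isEquivalence = record
              { refl  = lift (≼-refl , ≼-refl)
              ; sym   = λ (lift x≃y) → lift (swap x≃y)
              ; trans = λ (lift (x≼y , y≼x)) (lift (y≼z , z≼y)) →
                          lift (≼-trans x≼y y≼z , ≼-trans z≼y y≼x)
              }
            ; irrefl = λ (lift x≃y) (lift x≺y) → ≺⇒⋡ x≺y (proj₂ x≃y)
            ; trans = λ (lift x≺y) (lift y≺z) → lift (≺-≼-trans x≺y (≺⇒≼ y≺z))
            ; <-resp-≈ = (λ (lift y≃z) (lift x≺y) → lift (≺-≼-trans x≺y (proj₁ y≃z)))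
                       , (λ (lift y≃z) (lift y≺x) → lift (≼-≺-trans (proj₂ y≃z) y≺x))
            }
          ; compare = compare
          }
        }
      ; <-wellFounded = λ x → lift-acc (≺-wellFounded (lower x))
      }
      where
      compare : Trichotomous {A = Lift c A} (λ x y → Lift ℓ₁ (lower x ≃ lower y))
                                            (λ x y → Lift ℓ₂ (lower x ≺ lower y))
      compare (lift x) (lift y) with ≺-compare x y
      ... | tri< a b c = tri< (lift a) (b ∘ lower) (c ∘ lower)
      ... | tri≈ a b c = tri≈ (a ∘ lower) (lift b) (c ∘ lower)
      ... | tri> a b c = tri> (a ∘ lower) (b ∘ lower) (lift c)

      lift-acc : ∀ {x} → Acc _≺_ (lower x) →
                 Acc (λ (x y : Lift c A) → Lift ℓ₂ (lower x ≺ lower y)) x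
      lift-acc (acc rs) = acc λ (lift y≺x) → lift-acc (rs y≺x)

-- Descending walks from non-accessible nodes

module _ {n} {A : MCS n} (π : InfinitePath A) where

  infix 4 _⊏_

  -- With the strict arc at the end, any arc can be prepended; so along an arc of either label,
  -- everything below its target is also below its source.
  data _⊏_ (v : Node n) : Node n → Set where
    last : ∀ {u} → MultipathArc π u strict v → v ⊏ u
    _∷_  : ∀ {u r w} → MultipathArc π u r w → v ⊏ w → v ⊏ u

  ⊏-trans : Transitive _⊏_
  ⊏-trans w⊏v (last a)  = a ∷ w⊏v
  ⊏-trans w⊏v (a ∷ v⊏u) = a ∷ ⊏-trans w⊏v v⊏u

  module _ (em : ExcludedMiddle 0ℓ) where

    -- Excluded middle for the Σ-type itself also chooses v, so no separate choice
    -- axiom is needed to build the walk.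
    ¬acc⇒below : ∀ {u} → ¬ Acc _⊏_ u → ∃[ v ] (v ⊏ u × ¬ Acc _⊏_ v)
    ¬acc⇒below ¬acc-u = decidable-stable em λ none →
      ¬acc-u (acc λ v⊏u → decidable-stable em λ ¬acc-v → none (_ , v⊏u , ¬acc-v))

    -- A walk still to be completed, ending at a node from which another
    -- walk with a strict arc can be chosen.
    Itinerary : Set
    Itinerary = ∃[ u ] ∃[ v ] (v ⊏ u × ¬ Acc _⊏_ v)

    -- The pending walk is consumed arc by arc; a new one is chosen only once its final strict arc
    -- has been taken.
    advance : Itinerary → Itinerary
    advance (_ , v , last _  , ¬acc-v) = v , ¬acc⇒below ¬acc-v
    advance (_ , v , _ ∷ v⊏w , ¬acc-v) = _ , v , v⊏w , ¬acc-v

    firstLabel : Itinerary → Label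
    firstLabel (_ , _ , last _          , _) = strict
    firstLabel (_ , _ , _∷_ {r = r} _ _ , _) = r

    firstArc : ∀ s → MultipathArc π (proj₁ s) (firstLabel s) (proj₁ (advance s))
    firstArc (_ , _ , last a , _) = a
    firstArc (_ , _ , a ∷ _  , _) = a

    itinerary : Itinerary → ℕ → Itinerary
    itinerary s zero      = s
    itinerary s (ℕ.suc k) = advance (itinerary s k)

    strict-ahead : ∀ s k → ∃[ l ] (k ℕ.≤ l × firstLabel (itinerary s l) ≡ strict)
    strict-ahead s k = let _ , _ , v⊏u , _ = itinerary s k in go k v⊏u refl
      where
      -- The recursion is on the pending walk; the equation ties it to the itinerary at time `k`.
      go : ∀ k {u v ¬acc-v} (v⊏u : v ⊏ u) → itinerary s k ≡ (u , v , v⊏u , ¬acc-v) →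
           ∃[ l ] (k ℕ.≤ l × firstLabel (itinerary s l) ≡ strict)
      go k (last _)  eq = k , ≤-refl , cong firstLabel eq
      go k (_ ∷ v⊏w) eq =
        let l , k<l , isStrict = go (ℕ.suc k) v⊏w (cong advance eq)
        in l , <⇒≤ k<l , isStrict

    descendingWalk : Itinerary → Σ[ w ∈ InfiniteWalk π ] InfinitelyDescending w
    descendingWalk s = record
      { node  = proj₁ ∘ itinerary s
      ; label = firstLabel ∘ itinerary s
      ; step  = firstArc ∘ itinerary s
      } , strict-ahead s

    ⊏-wellFounded : ¬ (Σ[ w ∈ InfiniteWalk π ] InfinitelyDescending w) → WellFounded _⊏_
    ⊏-wellFounded noWalk u = decidable-stable em λ ¬acc-u →
      noWalk (descendingWalk (u , ¬acc⇒below ¬acc-u))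

-- Valuations of multipath nodes and runs

module Valuation {c ℓ₁ ℓ₂} (Val : WellOrderedSet c ℓ₁ ℓ₂) where
  open WellOrderedSet Val
  open StrictTotalOrder strictTotalOrder using (isEquivalence; trans; <-resp-≈)
  open StrictToNonStrict _≈_ _<_ using (<-≤-trans) renaming (trans to ≤-trans′)
  open Semantics Val

  ≤-trans : Transitive _≤_
  ≤-trans = ≤-trans′ isEquivalence <-resp-≈ trans

  Holds⇒≤ : ∀ {V} {ρ : V → Carrier} {u r v} → Holds ρ (u ▷[ r ] v) → ρ v ≤ ρ u
  Holds⇒≤ (holds-strict v<u)    = inj₁ v<u
  Holds⇒≤ (holds-nonstrict v≤u) = v≤u

  Holds-reindex : ∀ {V W} {ρ : V → Carrier} {ρ′ : W → Carrier} {u v u′ v′ r} →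
                  ρ u ≡ ρ′ u′ → ρ v ≡ ρ′ v′ →
                  Holds ρ (u ▷[ r ] v) → Holds ρ′ (u′ ▷[ r ] v′)
  Holds-reindex u≡ v≡ (holds-strict v<u)    = holds-strict (subst₂ _<_ v≡ u≡ v<u)
  Holds-reindex u≡ v≡ (holds-nonstrict v≤u) = holds-nonstrict (subst₂ _≤_ v≡ u≡ v≤u)

  joint≡place : ∀ {n} (value : Node n → Carrier) t x →
                joint (λ i → value (t , i)) (λ i → value (ℕ.suc t , i)) x ≡ value (place t x)
  joint≡place value t (unprimed i) = refl
  joint≡place value t (primed i)   = refl

  module _ {n} {A : MCS n} where
    open MCS A

    -- Such a valuation amounts to a run along `π`: `runRespects` and `respects⇒run` give the two
    -- directions.
    Respects : InfinitePath A → (Node n → Carrier) → Set _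
    Respects π value = ∀ {u r v} → MultipathArc π u r v → Holds value (u ▷[ r ] v)

    respects⇒¬descending : ∀ {π value} → Respects π value →
                           (w : InfiniteWalk π) → ¬ InfinitelyDescending w
    respects⇒¬descending {π} {value} respects w descending =
      go 0 (<-wellFounded _)
      where
      open InfiniteWalk w

      antitone : ∀ {k l} → k ℕ.≤′ l → value (node l) ≤ value (node k)
      antitone (ℕ.≤′-reflexive refl) = inj₂ (IsEquivalence.refl isEquivalence)
      antitone (ℕ.≤′-step k≤l) = ≤-trans (Holds⇒≤ (respects (step _))) (antitone k≤l)

      drop : ∀ {u r v} → r ≡ strict → Holds value (u ▷[ r ] v) → value v < value u
      drop refl (holds-strict v<u) = v<u

      go : ∀ k → Acc _<_ (value (node k)) → ⊥
      -- The value does not rise from `k` to `l` and drops across the strict arc, whose target is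
      -- node `l + 1`.
      go k (acc rs) =
        let l , k≤l , isStrict = descending k
        in go (ℕ.suc l) (rs (<-≤-trans trans (proj₁ <-resp-≈)
                              (drop isStrict (respects (step l)))
                              (antitone (≤⇒≤′ k≤l))))

    module _ (run : InfiniteRun A) where

      open Σ run renaming (proj₁ to state; proj₂ to transition)

      runPath : InfinitePath A
      runPath = record
        { flowPoint  = proj₁ ∘ state
        ; arc        = proj₁ ∘ transition
        ; source-arc = λ t → let _ , source≡ , _ = transition t in source≡
        ; target-arc = λ t → let _ , _ , target≡ , _ = transition t in target≡
        }

      runValue : Node n → Carrier
      runValue (t , i) = proj₂ (state t) i

      runRespects : Respects runPath runValue
      runRespects (mc-arc t {u} {r} {v} ∈mc) =
        let _ , _ , _ , _ , _ , σσ′⊨mc = transition t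
        in Holds-reindex (joint≡place runValue t u) (joint≡place runValue t v)
             (All.lookup σσ′⊨mc ∈mc)
      runRespects (inv-arc t ∈inv) =
        let _ , _ , _ , σ⊨inv , _ = transition t
        in Holds-reindex refl refl (All.lookup σ⊨inv ∈inv)

    respects⇒run : ∀ {π value} → Respects π value → InfiniteRun A
    respects⇒run {π} {value} respects =
        (λ t → flowPoint t , λ i → value (t , i))
      , λ t → arc t , source-arc t , target-arc t , ⊨inv t , ⊨inv (ℕ.suc t)
            , All.tabulate λ { {u ▷[ r ] v} ∈mc →
                Holds-reindex (sym (joint≡place value t u)) (sym (joint≡place value t v))
                  (respects (mc-arc t ∈mc)) }
      where
      open InfinitePath π
      ⊨inv : ∀ t → (λ i → value (t , i)) ⊨ invariant (flowPoint t)
      ⊨inv t = All.tabulate λ { {i ▷[ r ] j} ∈inv →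
        Holds-reindex refl refl (respects (inv-arc t ∈inv)) }

-- Multipath nodes as their own values

module _ (em : ExcludedMiddle 0ℓ) {n} {A : MCS n} (π : InfinitePath A)
         (noWalk : ¬ (Σ[ w ∈ InfiniteWalk π ] InfinitelyDescending w))
         (c ℓ₁ ℓ₂ : Level) where

  open Rank (⊏-trans π) (⊏-wellFounded π em noWalk)

  nodeOrder : WellOrderedSet c ℓ₁ ℓ₂
  nodeOrder = wellOrderedSet em c ℓ₁ ℓ₂

  open Semantics nodeOrder
  open Valuation nodeOrder

  lift-respects : Respects π lift
  lift-respects {r = strict}    a = holds-strict (lift (<⇒≺ (last a)))
  lift-respects {u} {nonstrict} {v} a = holds-nonstrict (v≤u (≼-or-≻ em u v))
    where
    v≼u : v ≼ u
    v≼u = below λ z⊏v → _ , (a ∷ z⊏v) , ≼-refl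

    -- `_≤_` requires a decision between smaller and equal rank, which the comparison in the other
    -- direction supplies.
    v≤u : u ≼ v ⊎ v ≺ u → WellOrderedSet._≤_ nodeOrder (lift v) (lift u)
    v≤u (inj₁ u≼v) = inj₂ (lift (v≼u , u≼v))
    v≤u (inj₂ v≺u) = inj₁ (lift v≺u)

theorem3p8 : ExcludedMiddle 0ℓ → ∀ c ℓ₁ ℓ₂ n (A : MCS n) →
    Terminating c ℓ₁ ℓ₂ A ⇔ SizeChangeTerminating A
theorem3p8 em c ℓ₁ ℓ₂ n A = mk⇔
  -- Excluded middle at the type of descending walks turns the contradiction into an actual walk.
  (λ terminating π → decidable-stable em λ noWalk →
    terminating (nodeOrder em π noWalk c ℓ₁ ℓ₂)
      (Valuation.respects⇒run _ (lift-respects em π noWalk c ℓ₁ ℓ₂)))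
  (λ sct Val run →
    let open Valuation Val
        w , descending = sct (runPath run)
    in respects⇒¬descending (runRespects run) w descending)
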